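{- Let $\mathsf{L}$ be a logic, $\mathcal{C}$ a class of $\mathsf{L}$-models, and $\Theta$ an $(\mathsf{L},\mathcal{C})$-pair (with, for each $M\in\mathcal{C}$, fixed functions $\mathsf{sem}^o_M$ witnessing the inductive property and a fixed set $\mathsf{SAT}_M$ as described in the context). Then the semantic enumeration procedure described in the context, run on a $\mathcal{C}$-sample $\mathcal{S}=(\mathcal{P},\mathcal{N})$, accepts if and only if $\mathcal{S}$ is $\mathsf{L}$-separable; that is, it decides the passive learning problem $\mathsf{PvLn}(\mathsf{L},\mathcal{C})$.
   Context: A logic $\mathsf{L}$ is given by a syntax $(\mathcal{T},\mathcal{T}_f,\mathsf{Op},(\tau_o)_{o\in\mathsf{Op}},T)$: $\mathcal{T}$ a non-empty finite set of types, $\emptyset\neq\mathcal{T}_f\subseteq\mathcal{T}$ final types, $\mathsf{Op}=\mathsf{Op}_0\uplus\mathsf{Op}_1\uplus\mathsf{Op}_2$ operators of arity 0,1,2 with $\mathsf{Op}_0\ne\emptyset$, each $o$ with a type $\tau_o\in\mathcal{T}$ and sets $T(o,i)\subseteq\mathcal{T}$ of allowed argument types. Formulas of type $\tau$, $\mathsf{Fm}_{\mathsf{L}}(\tau)$, are built inductively: $o\in\mathsf{Op}_0$ has type $\tau_o$; $o(\varphi_1)$ (resp. $o(\varphi_1,\varphi_2)$) has type $\tau_o$ when each $\varphi_i$ has a type in $T(o,i)$. $\mathsf{Fm}_{\mathsf{L}}(X)=\bigcup_{\tau\in X}\mathsf{Fm}_{\mathsf{L}}(\tau)$; final formulas are $\mathsf{Fm}^f_{\mathsf{L}}=\mathsf{Fm}_{\mathsf{L}}(\mathcal{T}_f)$.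 An $\mathsf{L}$-model $M$ has a satisfaction relation $M\models\varphi$ for final formulas; a class of $\mathsf{L}$-models is a set of them. A $\mathcal{C}$-sample is a pair $(\mathcal{P},\mathcal{N})$ of finite subsets of $\mathcal{C}$; it is $\mathsf{L}$-separable if some final formula $\varphi$ has $M\models\varphi$ for all $M\in\mathcal{P}$ and $M\not\models\varphi$ for all $M\in\mathcal{N}$. $\mathsf{PvLn}(\mathsf{L},\mathcal{C})$: given a $\mathcal{C}$-sample, decide whether it is $\mathsf{L}$-separable. An $(\mathsf{L},M)$-pair $(\mathsf{SEM}_M,\mathsf{sem}_M)$: a finite set $\mathsf{SEM}_M=\bigcup_\tau\mathsf{SEM}_M(\tau)$ (pairwise disjoint parts) and $\mathsf{sem}_M:\mathsf{Fm}_{\mathsf{L}}\to\mathsf{SEM}_M$ mapping type-$\tau$ formulas into $\mathsf{SEM}_M(\tau)$; $\mathsf{SEM}_M(X)=\bigcup_{\tau\in X}\mathsf{SEM}_M(\tau)$. It captures the $\mathsf{L}$-semantics if for all $\tau$ and all final $\varphi,\varphi'$ of type $\tau$ with $\mathsf{sem}_M(\varphi)=\mathsf{sem}_M(\varphi')$ we have $M\models\varphi$ iff $M\models\varphi'$; in that case fix a subset $\mathsf{SAT}_M\subseteq\mathsf{SEM}_M$ such that for every final $\varphi$, $M\models\varphi$ iff $\mathsf{sem}_M(\varphi)\in\mathsf{SAT}_M$. It satisfies the inductive property if for each $o\in\mathsf{Op}_1$ there is $\mathsf{sem}^o_M:\mathsf{SEM}_M(T(o,1))\to\mathsf{SEM}_M(\tau_o)$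 with $\mathsf{sem}_M(o(\varphi_1))=\mathsf{sem}^o_M(\mathsf{sem}_M(\varphi_1))$ for all $\varphi_1\in\mathsf{Fm}_{\mathsf{L}}(T(o,1))$, and for each $o\in\mathsf{Op}_2$ there is $\mathsf{sem}^o_M:\mathsf{SEM}_M(T(o,1))\times\mathsf{SEM}_M(T(o,2))\to\mathsf{SEM}_M(\tau_o)$ with $\mathsf{sem}_M(o(\varphi_1,\varphi_2))=\mathsf{sem}^o_M(\mathsf{sem}_M(\varphi_1),\mathsf{sem}_M(\varphi_2))$; fix such functions. An $(\mathsf{L},\mathcal{C})$-pair is a family $(\Theta_M)_{M\in\mathcal{C}}$ of $(\mathsf{L},M)$-pairs each capturing the $\mathsf{L}$-semantics and satisfying the inductive property. The procedure on input $\mathcal{S}=(\mathcal{P},\mathcal{N})$ (with $\mathcal{S}$ identified with $\mathcal{P}\cup\mathcal{N}$): start with the set $R$ of pairs $((\mathsf{sem}_M(o))_{M\in\mathcal{S}},\tau_o)$ for $o\in\mathsf{Op}_0$; repeatedly, until $R$ no longer changes, add for every $o\in\mathsf{Op}_1$ and every $(X,\tau_1)\in R$ with $\tau_1\in T(o,1)$ the pair $((\mathsf{sem}^o_M(X[M]))_{M\in\mathcal{S}},\tau_o)$, and for every $o\in\mathsf{Op}_2$ and all $(X_1,\tau_1),(X_2,\tau_2)\in R$ with $\tau_i\in T(o,i)$ the pair $((\mathsf{sem}^o_M(X_1[M],X_2[M]))_{M\in\mathcal{S}},\tau_o)$. Finally, accept iff there is $(X,\tau)\in R$ with $\tau\in\mathcal{T}_f$,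 $X[M]\in\mathsf{SAT}_M$ for all $M\in\mathcal{P}$ and $X[M]\in\mathsf{SEM}_M\setminus\mathsf{SAT}_M$ for all $M\in\mathcal{N}$; otherwise reject. -}

module Defs where

open import Data.Fin.Base using (Fin)
open import Data.Irrelevant using ([_])
open import Data.List.Base using (List)
open import Data.List.Membership.Propositional using (_∈_)
open import Data.Nat.Base using (ℕ; zero; suc; _<_)
open import Data.Product.Base using (Σ; Σ-syntax; ∃; ∃-syntax; _×_; _,_; map₂)
open import Data.Refinement.Base using (Refinement; Refinement-syntax; value; _,_)
open import Data.Sum.Base using (_⊎_; inj₁; inj₂)
open import Function.Bundles using (_↔_; _⇔_)
open import Level using (Level) renaming (suc to lsuc)
open import Relation.Binary.PropositionalEquality.Core using (_≡_)
open import Relation.Nullary.Negation.Core using (¬_)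
open import Relation.Unary using (Pred; Satisfiable; _≐_)

private
  variable
    a b p ℓ : Level

Finite : Set a → Set a
Finite A = ∃[ n ] (A ↔ Fin n)

-- For a family A of pairwise disjoint parts A(τ), the union ⋃_{τ ∈ X} A(τ).
-- The proof of τ ∈ X is irrelevant, so it does not create distinct elements.
infix 8 _⟪_⟫
_⟪_⟫ : {I : Set ℓ} → (I → Set ℓ) → Pred I ℓ → Set ℓ
_⟪_⟫ {I = I} A X = Σ[ τ ∈ [ τ ∈ I ∣ X τ ] ] A (value τ)

record Syntax ℓ : Set (lsuc ℓ) where
  field
    Type          : Set ℓ
    Type-finite   : Finite Type
    Type-nonempty : Type
    Final          : Pred Type ℓ
    Final-nonempty : Satisfiable Final
    Op₀ Op₁ Op₂  : Set ℓ
    Op₀-nonempty : Op₀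
    τ₀ : Op₀ → Type
    τ₁ : Op₁ → Type
    τ₂ : Op₂ → Type
    -- T₁ o = T(o,1) for unary o;  T₂ˡ o = T(o,1) and T₂ʳ o = T(o,2) for binary o
    T₁      : Op₁ → Pred Type ℓ
    T₂ˡ T₂ʳ : Op₂ → Pred Type ℓ

  data Fm : Type → Set ℓ where
    op₀ : (o : Op₀) → Fm (τ₀ o)
    op₁ : (o : Op₁) → Fm ⟪ T₁ o ⟫ → Fm (τ₁ o)
    op₂ : (o : Op₂) → Fm ⟪ T₂ˡ o ⟫ → Fm ⟪ T₂ʳ o ⟫ → Fm (τ₂ o)

  FinalFm : Set ℓ
  FinalFm = Fm ⟪ Final ⟫

record Logic ℓ : Set (lsuc ℓ) where
  infix 4 _⊨_
  field
    syn : Syntax ℓ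
  open Syntax syn public
  field
    Model : Set ℓ
    _⊨_   : Model → FinalFm → Set ℓ

module _ (L : Logic ℓ) where
  open Logic L

  record SemanticPair : Set (lsuc ℓ) where
    field
      SEM        : Type → Set ℓ
      SEM-finite : Finite (Σ Type SEM)
      sem        : ∀ {τ} → Fm τ → SEM τ

    sem⟪_⟫ : (X : Pred Type ℓ) → Fm ⟪ X ⟫ → SEM ⟪ X ⟫
    sem⟪ X ⟫ = map₂ sem

  module _ (M : Model) (Θ : SemanticPair) where
    open SemanticPair Θ

    CapturesSemantics : Set ℓ
    CapturesSemantics = ∀ (τ : [ τ ∈ Type ∣ Final τ ]) (φ φ′ : Fm (value τ)) →
      sem φ ≡ sem φ′ → (M ⊨ (τ , φ)) ⇔ (M ⊨ (τ , φ′))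

    record SatisfyingSet : Set (lsuc ℓ) where
      field
        SAT      : Pred (Σ Type SEM) ℓ
        SAT-spec : ∀ (τ : [ τ ∈ Type ∣ Final τ ]) (φ : Fm (value τ)) →
                   (M ⊨ (τ , φ)) ⇔ SAT (value τ , sem φ)

  module _ (Θ : SemanticPair) where
    open SemanticPair Θ

    record InductiveFunctions : Set ℓ where
      field
        sem₁ : (o : Op₁) → SEM ⟪ T₁ o ⟫ → SEM (τ₁ o)
        sem₂ : (o : Op₂) → SEM ⟪ T₂ˡ o ⟫ → SEM ⟪ T₂ʳ o ⟫ → SEM (τ₂ o)
        sem-op₁ : ∀ o φ → sem (op₁ o φ) ≡ sem₁ o (sem⟪ T₁ o ⟫ φ)
        sem-op₂ : ∀ o φ ψ →
          sem (op₂ o φ ψ) ≡ sem₂ o (sem⟪ T₂ˡ o ⟫ φ) (sem⟪ T₂ʳ o ⟫ ψ)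

  -- Membership in 𝒞 is irrelevant, so that families over 𝒞 depend only on the model.
  ClassMember : Pred Model ℓ → Set ℓ
  ClassMember 𝒞 = [ M ∈ Model ∣ 𝒞 M ]

  record ClassPair (𝒞 : Pred Model ℓ) : Set (lsuc ℓ) where
    field
      pair      : ClassMember 𝒞 → SemanticPair
      captures  : ∀ M → CapturesSemantics (value M) (pair M)
      satisfied : ∀ M → SatisfyingSet (value M) (pair M)
      functions : ∀ M → InductiveFunctions (pair M)

    module At (M : ClassMember 𝒞) where
      open SemanticPair (pair M) public
      open SatisfyingSet (satisfied M) public
      open InductiveFunctions (functions M) public

  -- A finite subset of 𝒞 is given by a list enumerating it; only membership
  -- in the list is ever used, so order and repetitions play no role.
  record Sample (𝒞 : Pred Model ℓ) : Set ℓ where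
    constructor _,_
    field
      𝒫 𝒩 : List (ClassMember 𝒞)

  Separable : {𝒞 : Pred Model ℓ} → Sample 𝒞 → Set ℓ
  Separable (𝒫 , 𝒩) = ∃[ φ ]
    (∀ M → M ∈ 𝒫 → value M ⊨ φ) × (∀ M → M ∈ 𝒩 → ¬ (value M ⊨ φ))

  module Procedure {𝒞 : Pred Model ℓ} (Θ : ClassPair 𝒞) (𝒮 : Sample 𝒞) where
    open ClassPair Θ
    open Sample 𝒮

    SampleMember : Set ℓ
    SampleMember = [ M ∈ ClassMember 𝒞 ∣ (M ∈ 𝒫) ⊎ (M ∈ 𝒩) ]

    Family : Type → Set ℓ
    Family τ = (M : SampleMember) → At.SEM (value M) τ

    -- The pairs (X, τ), type first.  X[M] ∈ SEM_M(τ) holds for every pair the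
    -- procedure generates, so it is made part of the typing.
    Entry : Set ℓ
    Entry = Σ Type Family

    -- Two families are the same tuple when they agree pointwise (function
    -- extensionality is not available), so sets of entries are generated
    -- up to _≗_.
    infix 4 _≗_
    _≗_ : ∀ {τ} → Family τ → Family τ → Set ℓ
    X ≗ Y = ∀ M → X M ≡ Y M

    data Init : Pred Entry ℓ where
      init : (o : Op₀) {Y : Family (τ₀ o)} →
             Y ≗ (λ M → At.sem (value M) (op₀ o)) → Init (τ₀ o , Y)

    data Step (R : Pred Entry ℓ) : Pred Entry ℓ where
      keep : ∀ {e} → R e → Step R e
      add₁ : (o : Op₁) (τ : [ τ ∈ Type ∣ T₁ o τ ]) (X : Family (value τ)) →
             R (value τ , X) →
             {Y : Family (τ₁ o)} →
             Y ≗ (λ M → At.sem₁ (value M) o (τ , X M)) →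
             Step R (τ₁ o , Y)
      add₂ : (o : Op₂)
             (τ  : [ τ ∈ Type ∣ T₂ˡ o τ ]) (X  : Family (value τ)) →
             (τ′ : [ τ ∈ Type ∣ T₂ʳ o τ ]) (X′ : Family (value τ′)) →
             R (value τ , X) → R (value τ′ , X′) →
             {Y : Family (τ₂ o)} →
             Y ≗ (λ M → At.sem₂ (value M) o (τ , X M) (τ′ , X′ M)) →
             Step R (τ₂ o , Y)

    stage : ℕ → Pred Entry ℓ
    stage zero    = Init
    stage (suc n) = Step (stage n)

    Stable : ℕ → Set ℓ
    Stable n = stage (suc n) ≐ stage n

    HaltsAt : ℕ → Set ℓ
    HaltsAt n = Stable n × (∀ m → m < n → ¬ Stable m)

    Accepting : Pred Entry ℓ → Set ℓ
    Accepting R = Σ[ τ ∈ [ τ ∈ Type ∣ Final τ ] ] Σ[ X ∈ Family (value τ) ]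
      R (value τ , X)
      × (∀ M (M∈𝒫 : M ∈ 𝒫) →   At.SAT M (value τ , X (M , [ inj₁ M∈𝒫 ])))
      × (∀ M (M∈𝒩 : M ∈ 𝒩) → ¬ At.SAT M (value τ , X (M , [ inj₂ M∈𝒩 ])))

    Halts Accepts Rejects : Set ℓ
    Halts   = ∃ HaltsAt
    Accepts = ∃[ n ] HaltsAt n ×   Accepting (stage n)
    Rejects = ∃[ n ] HaltsAt n × ¬ Accepting (stage n)

{-# OPTIONS --safe #-}

-- Read up to pointwise equality, the entries form a finite set, because a tuple
-- over the finitely many members of the sample takes values in finitely many
-- finite sets.  The stages increase, so by the pigeonhole principle they cannot
-- grow at every step.  Every generated entry is the tuple of semantic values of
-- some formula, and a stable stage contains the tuple of every formula (by
-- induction on the formula), hence acceptance at a stable stage amounts to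
-- separability.

module Submission where

open import Defs
open import Axiom.ExcludedMiddle using (ExcludedMiddle)
open import Data.Empty using (⊥-elim)
open import Data.Fin.Base using (Fin; zero; toℕ; combine)
open import Data.Fin.Properties using (combine-injective; pigeonhole; toℕ<n)
open import Data.Irrelevant using ([_])
open import Data.List.Base using (List; []; _∷_; _++_)
open import Data.List.Membership.Propositional using (_∈_; mapWith∈)
open import Data.List.Membership.Propositional.Properties using (∈-++⁺ˡ; ∈-++⁺ʳ)
open import Data.List.Relation.Unary.Any using (here; there)
open import Data.List.Relation.Unary.Any.Properties using (mapWith∈⁺)
open import Data.Nat.Base using (ℕ; zero; suc; _<_; _≤′_; ≤′-refl; ≤′-step; _*_)
open import Data.Nat.Properties using (≤⇒≤′; z≤′n; m<1+n⇒m<n∨m≡n; n<1+n)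
open import Data.Product.Base using (Σ-syntax; ∃; ∃-syntax; _×_; _,_; proj₁; proj₂)
open import Data.Product.Properties.WithK using (,-injectiveʳ)
open import Data.Refinement.Base using (value; _,_)
open import Data.Sum.Base using (_⊎_; inj₁; inj₂)
open import Function.Base using (_on_)
open import Function.Bundles using (_⇔_; mk⇔; Equivalence; Injection)
open import Function.Properties.Inverse using (↔⇒↣)
open import Level using (Level)
open import Relation.Binary.Core using (Rel)
open import Relation.Binary.PropositionalEquality
  using (_≡_; refl; sym; trans; cong; cong₂; subst)
open import Relation.Nullary.Decidable.Core using (yes; no; recompute)
open import Relation.Nullary.Negation.Core using (¬_; contradiction)
open import Relation.Unary using (Pred)

private
  variable
    a b r s : Level
    A : Set a
    B : Set b

-- Stated without quotients: _∼_ has finitely many classes once it contains the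
-- kernel of some map into a finite set.
FinitelyManyClasses : {A : Set a} → Rel A r → Set _
FinitelyManyClasses {A = A} _∼_ =
  ∃[ k ] Σ[ f ∈ (A → Fin k) ] (∀ {x y} → f x ≡ f y → x ∼ y)

finite⇒classes : Finite B → (g : A → B) → FinitelyManyClasses (_≡_ on g)
finite⇒classes (k , B↔Fin) g =
  k , (λ x → Injection.to B↣Fin (g x)) , Injection.injective B↣Fin
  where B↣Fin = ↔⇒↣ B↔Fin

×-classes : {_∼_ : Rel A r} {_≈_ : Rel A s} →
  FinitelyManyClasses _∼_ → FinitelyManyClasses _≈_ →
  FinitelyManyClasses (λ x y → (x ∼ y) × (x ≈ y))
×-classes (k , f , f-inj) (l , g , g-inj) =
  k * l , (λ x → combine (f x) (g x)) , λ {x} {y} eq →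
    let eqᶠ , eqᵍ = combine-injective (f x) (g x) (f y) (g y) eq
    in f-inj eqᶠ , g-inj eqᵍ

-- Iterated product over the list. For the empty list the relation is total, so a constant map into
-- `Fin 1` suffices.
all-classes : {_∼[_]_ : A → B → A → Set r} (zs : List B) →
  (∀ z → FinitelyManyClasses (λ x y → x ∼[ z ] y)) →
  FinitelyManyClasses (λ x y → ∀ z → z ∈ zs → x ∼[ z ] y)
all-classes []       classes = 1 , (λ _ → zero) , λ _ _ ()
all-classes (z ∷ zs) classes
  with k , f , f-inj ← ×-classes (classes z) (all-classes zs classes) =
  k , f , λ where
    eq _  (here refl)  → proj₁ (f-inj eq)
    eq z′ (there z′∈zs) → proj₂ (f-inj eq) z′ z′∈zs

-- Halting means the first stable stage, so a bounded search is made; excluded middle decides `P` at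
-- each step.
none-or-least : ExcludedMiddle r → (P : Pred ℕ r) → ∀ k →
  (∀ m → m < k → ¬ P m) ⊎ (∃[ n ] P n × (∀ m → m < n → ¬ P m))
none-or-least em P zero = inj₁ λ _ ()
none-or-least em P (suc k) with none-or-least em P k
... | inj₂ found = inj₂ found
... | inj₁ none with em {P k}
...   | yes Pk = inj₂ (k , Pk , none)
...   | no ¬Pk = inj₁ λ m m<1+k → case-last m (m<1+n⇒m<n∨m≡n m<1+k)
  where
  case-last : ∀ m → (m < k) ⊎ (m ≡ k) → ¬ P m
  case-last m (inj₁ m<k)  = none m m<k
  case-last m (inj₂ refl) = ¬Pk

module _ {ℓ} (em : ExcludedMiddle ℓ) (L : Logic ℓ)
         {𝒞 : Pred (Logic.Model L) ℓ} (Θ : ClassPair L 𝒞) (𝒮 : Sample L 𝒞) where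
  open Logic L
  open ClassPair Θ
  open Sample 𝒮
  open Procedure L Θ 𝒮

  positive : ∀ {M} → M ∈ 𝒫 → SampleMember
  positive {M} M∈𝒫 = M , [ inj₁ M∈𝒫 ]

  negative : ∀ {M} → M ∈ 𝒩 → SampleMember
  negative {M} M∈𝒩 = M , [ inj₂ M∈𝒩 ]

  members : List SampleMember
  members = mapWith∈ 𝒫 positive ++ mapWith∈ 𝒩 negative

  ∈-members : ∀ M → M ∈ members
  -- The irrelevant proof cannot be matched on directly; excluded middle recovers a usable one.
  -- Irrelevance also makes `refl` enough below, whichever proof is recovered.
  ∈-members (M , [ M∈𝒮 ]) with recompute em M∈𝒮
  ... | inj₁ M∈𝒫 = ∈-++⁺ˡ (mapWith∈⁺ positive (M , M∈𝒫 , refl))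
  ... | inj₂ M∈𝒩 = ∈-++⁺ʳ (mapWith∈ 𝒫 positive) (mapWith∈⁺ negative (M , M∈𝒩 , refl))

  -- The first component matters for the empty sample only.
  infix 4 _≋_
  _≋_ : Rel Entry ℓ
  (τ , X) ≋ (τ′ , X′) =
    (τ ≡ τ′) × (∀ M → M ∈ members → _≡_ {A = ∃ (At.SEM (value M))} (τ , X M) (τ′ , X′ M))

  -- Each value is kept together with its type, so that entries of different types are compared
  -- inside one finite set `Σ Type SEM`.
  ≋-classes : FinitelyManyClasses _≋_
  ≋-classes = ×-classes (finite⇒classes Type-finite proj₁)
    (all-classes members λ M →
      finite⇒classes (At.SEM-finite (value M)) (λ (τ , X) → τ , X M))

  -- Every generating rule admits all tuples pointwise equal to the computed one, so transitivity
  -- closes each case.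
  stage-resp-≗ : ∀ n {τ} {X Y : Family τ} → Y ≗ X → stage n (τ , X) → stage n (τ , Y)
  stage-resp-≗ zero    Y≗X (init o X≗) = init o λ M → trans (Y≗X M) (X≗ M)
  stage-resp-≗ (suc n) Y≗X (keep e∈) = keep (stage-resp-≗ n Y≗X e∈)
  stage-resp-≗ (suc n) Y≗X (add₁ o τ Z Z∈ X≗) =
    add₁ o τ Z Z∈ λ M → trans (Y≗X M) (X≗ M)
  stage-resp-≗ (suc n) Y≗X (add₂ o τ Z τ′ Z′ Z∈ Z′∈ X≗) =
    add₂ o τ Z τ′ Z′ Z∈ Z′∈ λ M → trans (Y≗X M) (X≗ M)

  stage-resp-≋ : ∀ n {e e′} → e ≋ e′ → stage n e → stage n e′
  stage-resp-≋ n (refl , X≋Y) =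
    stage-resp-≗ n λ M → sym (,-injectiveʳ (X≋Y M (∈-members M)))

  stage-mono : ∀ {m n e} → m ≤′ n → stage m e → stage n e
  stage-mono ≤′-refl       e∈ = e∈
  stage-mono (≤′-step m≤n) e∈ = keep (stage-mono m≤n e∈)

  -- By `keep` a stage is always contained in the next, so instability can only come from an added
  -- entry.
  unstable⇒new : ∀ {n} → ¬ Stable n → ∃[ e ] stage (suc n) e × ¬ stage n e
  unstable⇒new {n} unstable with em {∃[ e ] stage (suc n) e × ¬ stage n e}
  ... | yes new = new
  ... | no ¬new = contradiction (old , keep) unstable
    where
    old : ∀ {e} → stage (suc n) e → stage n e
    old {e} e∈ with em {stage n e}
    ... | yes e∈′ = e∈′
    ... | no  e∉  = contradiction (e , e∈ , e∉) ¬new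

  halts : Halts
  halts with ≋-classes
  ... | k , code , code-inj with none-or-least em Stable (suc k)
  ...   | inj₂ halt = halt
  ...   | inj₁ unstable = ⊥-elim (repetition (pigeonhole (n<1+n k) λ i → code (proj₁ (new i))))
    where
    new : (i : Fin (suc k)) → ∃[ e ] stage (suc (toℕ i)) e × ¬ stage (toℕ i) e
    new i = unstable⇒new (unstable (toℕ i) (toℕ<n i))

    repetition : ¬ (∃[ i ] ∃[ j ] toℕ i < toℕ j × code (proj₁ (new i)) ≡ code (proj₁ (new j)))
    -- `i<j` unfolds to `suc (toℕ i) ≤ toℕ j`: the entry new after stage `i` already lies in stage
    -- `j`, and so does its equivalent, which was to be absent there.
    repetition (i , j , i<j , eq) =
      proj₂ (proj₂ (new j))
        (stage-resp-≋ (toℕ j) (code-inj eq)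
          (stage-mono (≤⇒≤′ i<j) (proj₁ (proj₂ (new i)))))

  ⟦_⟧ : ∀ {τ} → Fm τ → Family τ
  ⟦ φ ⟧ M = At.sem (value M) φ

  -- The inductive property turns `sem₁` or `sem₂` of tuples of formulas into the tuple of the
  -- compound formula.
  stage-sound : ∀ n {τ} {X : Family τ} → stage n (τ , X) → ∃[ φ ] X ≗ ⟦ φ ⟧
  stage-sound zero    (init o X≗) = op₀ o , X≗
  stage-sound (suc n) (keep e∈) = stage-sound n e∈
  stage-sound (suc n) (add₁ o τ X X∈ Y≗) with φ , X≗φ ← stage-sound n X∈ =
    op₁ o (τ , φ) , λ M →
      trans (Y≗ M)
        (trans (cong (λ x → At.sem₁ (value M) o (τ , x)) (X≗φ M))
          (sym (At.sem-op₁ (value M) o (τ , φ))))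
  stage-sound (suc n) (add₂ o τ X τ′ X′ X∈ X′∈ Y≗)
    with φ , X≗φ ← stage-sound n X∈ | ψ , X′≗ψ ← stage-sound n X′∈ =
    op₂ o (τ , φ) (τ′ , ψ) , λ M →
      trans (Y≗ M)
        (trans (cong₂ (λ x x′ → At.sem₂ (value M) o (τ , x) (τ′ , x′)) (X≗φ M) (X′≗ψ M))
          (sym (At.sem-op₂ (value M) o (τ , φ) (τ′ , ψ))))

  stable-complete : ∀ {n} → Stable n → ∀ {τ} (φ : Fm τ) → stage n (τ , ⟦ φ ⟧)
  stable-complete {n} _ (op₀ o) = stage-mono z≤′n (init o λ _ → refl)
  -- The compound formula's tuple enters at stage `suc n`; stability brings it back to stage `n`.
  stable-complete stable (op₁ o (τ , φ)) =
    proj₁ stable (add₁ o τ ⟦ φ ⟧ (stable-complete stable φ)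
      λ M → At.sem-op₁ (value M) o (τ , φ))
  stable-complete stable (op₂ o (τ , φ) (τ′ , ψ)) =
    proj₁ stable (add₂ o τ ⟦ φ ⟧ τ′ ⟦ ψ ⟧ (stable-complete stable φ) (stable-complete stable ψ)
      λ M → At.sem-op₂ (value M) o (τ , φ) (τ′ , ψ))

  accepting⇒separable : ∀ n → Accepting (stage n) → Separable L 𝒮
  accepting⇒separable n (τ , X , X∈ , pos , neg) with φ , X≗φ ← stage-sound n X∈ =
    (τ , φ)
    , (λ M M∈𝒫 → Equivalence.from (At.SAT-spec M τ φ)
        (subst (λ x → At.SAT M (value τ , x)) (X≗φ _) (pos M M∈𝒫)))
    , (λ M M∈𝒩 M⊨φ → neg M M∈𝒩
        (subst (λ x → At.SAT M (value τ , x)) (sym (X≗φ _))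
          (Equivalence.to (At.SAT-spec M τ φ) M⊨φ)))

  separable⇒accepting : ∀ {n} → Stable n → Separable L 𝒮 → Accepting (stage n)
  separable⇒accepting stable ((τ , φ) , pos , neg) =
    τ , ⟦ φ ⟧ , stable-complete stable φ
    , (λ M M∈𝒫 → Equivalence.to (At.SAT-spec M τ φ) (pos M M∈𝒫))
    , (λ M M∈𝒩 sat → neg M M∈𝒩 (Equivalence.from (At.SAT-spec M τ φ) sat))

theorem2 : ∀ {ℓ} → ExcludedMiddle ℓ →
    (L : Logic ℓ) (𝒞 : Pred (Logic.Model L) ℓ) (Θ : ClassPair L 𝒞) (𝒮 : Sample L 𝒞) →
    Procedure.Halts L Θ 𝒮
    × (Procedure.Accepts L Θ 𝒮 ⇔ Separable L 𝒮)
    × (Procedure.Rejects L Θ 𝒮 ⇔ (¬ Separable L 𝒮))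
theorem2 em L 𝒞 Θ 𝒮 with n , halt@(stable , _) ← halts em L Θ 𝒮 =
  (n , halt)
  , mk⇔ (λ (m , _ , acc) → accepting⇒separable em L Θ 𝒮 m acc)
        (λ sep → n , halt , separable⇒accepting em L Θ 𝒮 stable sep)
  -- The stage of the given rejection need not be identified with `n`, since completeness holds at
  -- every stable stage.
  , mk⇔ (λ (_ , (stable′ , _) , ¬acc) sep → ¬acc (separable⇒accepting em L Θ 𝒮 stable′ sep))
        (λ ¬sep → n , halt , λ acc → ¬sep (accepting⇒separable em L Θ 𝒮 n acc))
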